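{- Let $\mathbf{D}$ be a totally ordered divisible Abelian $\ell$-group and let $\varphi=\forall x_1\dots x_n\exists! z_1\dots z_m\,\alpha(\bar x,\bar z)$ be an EFD-sentence that holds in $\mathbf{D}$. Then the functions $[\varphi]_1^\mathbf{D},\dots,[\varphi]_m^\mathbf{D}$ defined by $\varphi$ on $\mathbf{D}$ are term-functions of $\overline{\mathbf{D}}$.
   Context: Abelian $\ell$-groups are algebras in the language $\{+,-,0,\vee,\wedge\}$ where $(A,+,-,0)$ is an Abelian group, $(A,\vee,\wedge)$ a lattice and $a+(b\vee c)=(a+b)\vee(a+c)$. An $\ell$-group $\mathbf G$ is divisible if for every $g\in G$ and positive integer $n$ there is $h\in G$ with $nh=g$. An EFD-sentence is a sentence $\forall x_1\dots x_n\exists! z_1\dots z_m\bigwedge_{i=1}^k s_i(\bar x,\bar z)=t_i(\bar x,\bar z)$ with terms $s_i,t_i$, $n\ge0$, $m\ge1$; if it holds in $\mathbf A$, the system defines a function $F:A^n\to A^m$, whose coordinate functions are denoted $[\varphi]_1^\mathbf A,\dots,[\varphi]_m^\mathbf A$. For each positive integer $k$, $\delta_k:=\forall x\exists! z\,kz=x$; for a divisible $\mathbf D$ (which satisfies all $\delta_k$, $\ell$-groups being torsion-free), $\overline{\mathbf D}:=(\mathbf D,([\delta_k]^\mathbf D)_{k\ge1})$ is $\mathbf D$ expanded by all the division operations $x\mapsto x/k$. -}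

module Defs where

open import Level using (0ℓ)
open import Data.Nat using (ℕ; zero; suc)
open import Data.Fin using (Fin)
open import Data.Sum using (_⊎_; inj₁; inj₂)
open import Data.Product using (Σ; _×_; _,_; proj₁)
open import Data.List using (List)
open import Data.List.Relation.Unary.All using (All)
open import Relation.Binary.PropositionalEquality using (_≡_)
open import Algebra.Core using (Op₁; Op₂)
import Algebra.Structures as AS
import Algebra.Lattice.Structures as LS

record AbelianLGroup : Set₁ where
  infixl 6 _+_
  infixr 7 _∨_ _∧_
  field
    Carrier : Set
    _+_     : Op₂ Carrier
    -_      : Op₁ Carrier
    𝟘       : Carrier
    _∨_     : Op₂ Carrier
    _∧_     : Op₂ Carrier
    isAbelianGroup : AS.IsAbelianGroup {A = Carrier} _≡_ _+_ 𝟘 -_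
    isLattice      : LS.IsLattice {A = Carrier} _≡_ _∨_ _∧_
    +-distrib-∨    : ∀ a b c → a + (b ∨ c) ≡ (a + b) ∨ (a + c)

  _·_ : ℕ → Carrier → Carrier
  zero  · g = 𝟘
  suc n · g = g + (n · g)

TotallyOrdered : AbelianLGroup → Set
TotallyOrdered G = ∀ a b → (a ∨ b ≡ b) ⊎ (b ∨ a ≡ a)
  where open AbelianLGroup G

Divisible : AbelianLGroup → Set
Divisible G = ∀ (g : Carrier) (n : ℕ) → Σ Carrier (λ h → suc n · h ≡ g)
  where open AbelianLGroup G

data Term (V : Set) : Set where
  var  : V → Term V
  _⊕_  : Term V → Term V → Term V
  ⊝_   : Term V → Term V
  zer  : Term V
  _⊔_  : Term V → Term V → Term V
  _⊓_  : Term V → Term V → Term V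

module _ (G : AbelianLGroup) where
  open AbelianLGroup G

  ⟦_⟧ : {V : Set} → Term V → (V → Carrier) → Carrier
  ⟦ var v ⟧ ρ = ρ v
  ⟦ s ⊕ t ⟧ ρ = ⟦ s ⟧ ρ + ⟦ t ⟧ ρ
  ⟦ ⊝ t ⟧ ρ   = - (⟦ t ⟧ ρ)
  ⟦ zer ⟧ ρ   = 𝟘
  ⟦ s ⊔ t ⟧ ρ = ⟦ s ⟧ ρ ∨ ⟦ t ⟧ ρ
  ⟦ s ⊓ t ⟧ ρ = ⟦ s ⟧ ρ ∧ ⟦ t ⟧ ρ

-- EFD-sentences  ∀ x₁…xₙ ∃! z₁…zₘ ⋀ᵢ sᵢ(x̄,z̄) = tᵢ(x̄,z̄)
-- (variables x are inj₁ i, variables z are inj₂ j; the conjunction is a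
-- finite list of equations; m ≥ 1 is expressed by the index suc m)

record EFD (n m : ℕ) : Set where
  constructor efd
  field
    equations : List (Term (Fin n ⊎ Fin (suc m)) × Term (Fin n ⊎ Fin (suc m)))

module _ (G : AbelianLGroup) where
  open AbelianLGroup G

  Sat : ∀ {n m} → EFD n m → (Fin n → Carrier) → (Fin (suc m) → Carrier) → Set
  Sat {n} {m} φ x z = All (λ e → ⟦ G ⟧ (Data.Product.proj₁ e) ρ ≡ ⟦ G ⟧ (Data.Product.proj₂ e) ρ)
                          (EFD.equations φ)
    where
    ρ : Fin n ⊎ Fin (suc m) → Carrier
    ρ (inj₁ i) = x i
    ρ (inj₂ j) = z j

  Holds : ∀ {n m} → EFD n m → Set
  Holds {n} {m} φ =
    ∀ (x : Fin n → Carrier) →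
      Σ (Fin (suc m) → Carrier) λ z →
        Sat φ x z × (∀ z′ → Sat φ x z′ → ∀ j → z′ j ≡ z j)

  [_]_ : ∀ {n m} {φ : EFD n m} → Holds φ → Fin (suc m) → (Fin n → Carrier) → Carrier
  [ h ] j = λ x → proj₁ (h x) j

-- Terms of the expanded language of D̄ : additionally a unary symbol
-- for division by k for each k ≥ 1 (div n t means t/(suc n))

data DTerm (V : Set) : Set where
  var  : V → DTerm V
  _⊕_  : DTerm V → DTerm V → DTerm V
  ⊝_   : DTerm V → DTerm V
  zer  : DTerm V
  _⊔_  : DTerm V → DTerm V → DTerm V
  _⊓_  : DTerm V → DTerm V → DTerm V
  div  : ℕ → DTerm V → DTerm V

module _ (D : AbelianLGroup) (div-D : Divisible D) where
  open AbelianLGroup D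

  -- x ↦ x/(suc k): the witness provided by divisibility (it is the unique
  -- solution of (suc k)·z = x since ℓ-groups are torsion-free, i.e. [δ_{suc k}]^D)
  _/suc_ : Carrier → ℕ → Carrier
  g /suc k = proj₁ (div-D g k)

  ⟦_⟧̄ : {V : Set} → DTerm V → (V → Carrier) → Carrier
  ⟦ var v ⟧̄ ρ = ρ v
  ⟦ s ⊕ t ⟧̄ ρ = ⟦ s ⟧̄ ρ + ⟦ t ⟧̄ ρ
  ⟦ ⊝ t ⟧̄ ρ   = - (⟦ t ⟧̄ ρ)
  ⟦ zer ⟧̄ ρ   = 𝟘
  ⟦ s ⊔ t ⟧̄ ρ = ⟦ s ⟧̄ ρ ∨ ⟦ t ⟧̄ ρ
  ⟦ s ⊓ t ⟧̄ ρ = ⟦ s ⟧̄ ρ ∧ ⟦ t ⟧̄ ρ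
  ⟦ div k t ⟧̄ ρ = ⟦ t ⟧̄ ρ /suc k

  IsTermFunctionD̄ : ∀ {n} → ((Fin n → Carrier) → Carrier) → Set
  IsTermFunctionD̄ {n} f = Σ (DTerm (Fin n)) λ t → ∀ x → ⟦ t ⟧̄ x ≡ f x

module Submission where

-- On a totally ordered D the system α(x,z) is a finite union of cells, each given
-- by inequalities a(x,z) ≥ 0 between integer linear forms.  Uniqueness says that
-- for any two cells P, Q the inequalities P(x,z), Q(x,z′) imply z_j ≤ z′_j.  By
-- Farkas' lemma over ℤ either D = 0 or z′_j − z_j is a nonnegative rational
-- combination of the inequalities; the x-part of its P-half is a linear form A_PQ
-- such that z_j ≤ A_PQ(x) on P and A_PQ(x) ≤ z_j on Q.
-- Therefore [φ]_j = ⋁_P ⋀_Q A_PQ: if P is a cell containing (x,z), every A_PQ(x)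
-- is ≥ z_j, whereas A_RP(x) ≤ z_j for every cell R.

open import Defs
open import Algebra.Bundles using (AbelianGroup)
import Algebra.Lattice.Bundles as Alg
import Algebra.Lattice.Properties.Lattice
import Algebra.Properties.AbelianGroup
import Algebra.Properties.CommutativeMonoid.Mult
import Algebra.Properties.CommutativeMonoid.Sum
import Algebra.Properties.CommutativeSemigroup
open import Data.Empty using (⊥-elim)
open import Data.Fin using (Fin; zero; suc; _↑ˡ_; _↑ʳ_)
open import Data.Fin.Properties using (any?)
open import Data.Integer using (ℤ; +_; -[1+_]; +[1+_]; 0ℤ; 1ℤ; -1ℤ; ∣_∣; +≤+; _⊖_)
import Data.Integer as Int
import Data.Integer.Properties as ℤₚ
open import Data.Integer.Tactic.RingSolver using (solve-∀)
open import Data.List using (List; []; _∷_; map; _++_; foldr)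
open import Data.List.Membership.Propositional using (_∈_; find; lose)
open import Data.List.Membership.Propositional.Properties using (∈-map⁺)
open import Data.List.Relation.Unary.All using (All; []; _∷_)
import Data.List.Relation.Unary.All as All
import Data.List.Relation.Unary.All.Properties as All
open import Data.List.Relation.Unary.Any using (Any; here; there)
import Data.List.Relation.Unary.Any as Any
import Data.List.Relation.Unary.Any.Properties as Any
open import Data.Nat as ℕ using (ℕ; zero; suc)
import Data.Nat.Properties as ℕₚ
open import Data.Product using (∃; ∃₂; _×_; _,_; proj₁; proj₂)
open import Data.Sum using (_⊎_; inj₁; inj₂; [_,_]′)
import Data.Vec.Functional as V
import Data.Vec.Functional.Properties as V
open import Function using (_∘_; id)
open import Relation.Binary using (tri<; tri≈; tri>)
import Relation.Binary.Lattice
open import Relation.Binary.PropositionalEquality hiding (poset)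
import Relation.Binary.Reasoning.PartialOrder
open import Relation.Nullary using (yes; no; ¬?)
open import Relation.Nullary.Decidable using (decidable-stable)

-- Integer linear forms and their nonnegative combinations.

data Linear (V : Set) : Set where
  var : V → Linear V
  zer : Linear V
  _⊕_ : Linear V → Linear V → Linear V
  _⊛_ : ℤ → Linear V → Linear V

rename : ∀ {V W} → (V → W) → Linear V → Linear W
rename σ (var v) = var (σ v)
rename σ zer     = zer
rename σ (s ⊕ t) = rename σ s ⊕ rename σ t
rename σ (c ⊛ t) = c ⊛ rename σ t

-- Missing multipliers count as 0 and surplus ones are ignored, so that no lengths have to be
-- matched.
combination : ∀ {I V : Set} → (I → Linear V) → List ℕ → List I → Linear V
combination f []       is       = zer
combination f (u ∷ us) []       = zer
combination f (u ∷ us) (i ∷ is) = ((+ u) ⊛ f i) ⊕ combination f us is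

-- Linear forms over the integers.

module _ where
  open Int using (_+_; _*_; _≤_)

  +-nonNeg : ∀ {a b} → 0ℤ ≤ a → 0ℤ ≤ b → 0ℤ ≤ a + b
  +-nonNeg = ℤₚ.+-mono-≤

  *-nonNeg : ∀ u {a} → 0ℤ ≤ a → 0ℤ ≤ (+ u) * a
  *-nonNeg u {a} 0≤a = subst (_≤ (+ u) * a) (ℤₚ.*-zeroʳ (+ u)) (ℤₚ.*-monoˡ-≤-nonNeg (+ u) 0≤a)

module _ {V : Set} where
  open Int using (_+_; _*_; -_; _-_; _≤_; _<_)

  evalℤ : Linear V → (V → ℤ) → ℤ
  evalℤ (var v) y = y v
  evalℤ zer     y = 0ℤ
  evalℤ (s ⊕ t) y = evalℤ s y + evalℤ t y
  evalℤ (c ⊛ t) y = c * evalℤ t y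

  evalℤ-linear : ∀ a b (y x : V → ℤ) t →
    evalℤ t (λ v → a * y v + b * x v) ≡ a * evalℤ t y + b * evalℤ t x
  evalℤ-linear a b y x (var v) = refl
  evalℤ-linear a b y x zer     = lemma a b
    where
    lemma : ∀ a b → 0ℤ ≡ a * 0ℤ + b * 0ℤ
    lemma = solve-∀
  evalℤ-linear a b y x (s ⊕ t)
    rewrite evalℤ-linear a b y x s | evalℤ-linear a b y x t =
    lemma a b (evalℤ s y) (evalℤ s x) (evalℤ t y) (evalℤ t x)
    where
    lemma : ∀ a b p q r s → (a * p + b * q) + (a * r + b * s) ≡ a * (p + r) + b * (q + s)
    lemma = solve-∀
  evalℤ-linear a b y x (c ⊛ t) rewrite evalℤ-linear a b y x t =
    lemma a b c (evalℤ t y) (evalℤ t x)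
    where
    lemma : ∀ a b c p q → c * (a * p + b * q) ≡ a * (c * p) + b * (c * q)
    lemma = solve-∀

  module _ {I : Set} where

    combination-nonNeg : ∀ (f : I → Linear V) us {is x} →
      All (λ i → 0ℤ ≤ evalℤ (f i) x) is → 0ℤ ≤ evalℤ (combination f us is) x
    combination-nonNeg f []       ps       = +≤+ ℕ.z≤n
    combination-nonNeg f (u ∷ us) []       = +≤+ ℕ.z≤n
    combination-nonNeg f (u ∷ us) (p ∷ ps) = +-nonNeg (*-nonNeg u p) (combination-nonNeg f us ps)

    combination-scale : ∀ (f : I → Linear V) d us is y →
      evalℤ (combination f (map (d ℕ.*_) us) is) y ≡ (+ d) * evalℤ (combination f us is) y
    combination-scale f d []       is       y = sym (ℤₚ.*-zeroʳ (+ d))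
    combination-scale f d (u ∷ us) []       y = sym (ℤₚ.*-zeroʳ (+ d))
    combination-scale f d (u ∷ us) (i ∷ is) y = trans
      (cong₂ _+_ (cong (_* evalℤ (f i) y) (ℤₚ.pos-* d u)) (combination-scale f d us is y))
      (lemma (+ d) (+ u) (evalℤ (f i) y) (evalℤ (combination f us is) y))
      where
      lemma : ∀ d u a c → (d * u) * a + d * c ≡ d * (u * a + c)
      lemma = solve-∀

  -- With d = − α(x) the projected form vanishes at x.
  project : ℤ → Linear V → (V → ℤ) → Linear V → Linear V
  project d α x t = (d ⊛ t) ⊕ (evalℤ t x ⊛ α)

  -- `project d α x` is linear in the projected form, hence commutes with combinations.
  combination-project : ∀ {I : Set} (f : I → Linear V) d α x us is y →
    evalℤ (combination (project d α x ∘ f) us is) y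
      ≡ evalℤ (project d α x (combination f us is)) y
  combination-project f d α x []       is       y = lemma d (evalℤ α y)
    where
    lemma : ∀ d a → 0ℤ ≡ d * 0ℤ + 0ℤ * a
    lemma = solve-∀
  combination-project f d α x (u ∷ us) []       y = combination-project f d α x [] [] y
  combination-project f d α x (u ∷ us) (i ∷ is) y
    rewrite combination-project f d α x us is y =
    lemma (+ u) d (evalℤ (f i) y) (evalℤ (f i) x) (evalℤ α y)
      (evalℤ (combination f us is) y) (evalℤ (combination f us is) x)
    where
    lemma : ∀ u d p q a r s →
      u * (d * p + q * a) + (d * r + s * a) ≡ d * (u * p + r) + (u * q + s) * a
    lemma = solve-∀

-- Farkas' lemma over the integers.

δ : ∀ {N} → Fin N → Fin N → ℤ
δ zero    zero    = 1ℤ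
δ zero    (suc j) = 0ℤ
δ (suc i) zero    = 0ℤ
δ (suc i) (suc j) = δ i j

module _ {I : Set} {N : ℕ} where
  open Int using (_+_; _*_; -_; _-_; _≤_; _<_)

  Violation : (I → Linear (Fin N)) → List I → Linear (Fin N) → Set
  Violation f is γ = ∃ λ x → All (λ i → 0ℤ ≤ evalℤ (f i) x) is × evalℤ γ x < 0ℤ

  -- The value of a form at `δ e` is its coefficient at e, so the two forms are compared
  -- coefficientwise. The factor k + 1 clears the denominators of the rational multipliers, which
  -- leaves natural numbers in `us`.
  Certificate : (I → Linear (Fin N)) → List I → Linear (Fin N) → Set
  Certificate f is γ = ∃₂ λ k us → ∀ e →
    +[1+ k ] * evalℤ γ (δ e) ≡ evalℤ (combination f us is) (δ e)

  -- Bartl's induction on the number of constraints: if x violates only the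
  -- new constraint α, project everything along x and solve the smaller system.
  farkas : ∀ f is γ → Violation f is γ ⊎ Certificate f is γ
  -- Without constraints only the zero form has a certificate; otherwise a unit vector or its
  -- negative makes γ negative.
  farkas f [] γ with any? (λ e → ¬? (evalℤ γ (δ e) ℤₚ.≟ 0ℤ))
  ... | no allZero = inj₂ (0 , [] , λ e →
    cong (1ℤ *_) (decidable-stable (_ ℤₚ.≟ _) λ ne → allZero (e , ne)))
  ... | yes (e , γe≢0) with ℤₚ.<-cmp (evalℤ γ (δ e)) 0ℤ
  ...   | tri< γe<0 _ _ = inj₁ (δ e , [] , γe<0)
  ...   | tri≈ _ γe≡0 _ = ⊥-elim (γe≢0 γe≡0)
  ...   | tri> _ _ γe>0 = inj₁ (_ , [] ,
    subst (_< 0ℤ) (trans (lemma (evalℤ γ (δ e))) (sym (evalℤ-linear -1ℤ 0ℤ (δ e) (δ e) γ)))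
      (ℤₚ.neg-mono-< γe>0))
    where
    lemma : ∀ a → - a ≡ -1ℤ * a + 0ℤ * a
    lemma = solve-∀
  farkas f (i ∷ is) γ with farkas f is γ
  ... | inj₂ (k , us , eq) = inj₂ (k , 0 ∷ us , λ e →
    trans (eq e) (lemma (evalℤ (f i) (δ e)) _))
    where
    lemma : ∀ a b → b ≡ 0ℤ * a + b
    lemma = solve-∀
  ... | inj₁ (x , ps , γx<0) with evalℤ (f i) x in αx
  ...   | + a = inj₁ (x , subst (0ℤ ≤_) (sym αx) (+≤+ ℕ.z≤n) ∷ ps , γx<0)
  ...   | -[1+ a ] with farkas (project +[1+ a ] (f i) x ∘ f) is (project +[1+ a ] (f i) x γ)
  ...     | inj₁ (y , qs , γ′y<0) = inj₁ (w ,
      ℤₚ.≤-reflexive (sym αw≡0) ∷ All.map (λ {j} → subst (0ℤ ≤_) (shift (f j))) qs ,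
      subst (_< 0ℤ) (shift γ) γ′y<0)
    where
    -- `w` is d y + α(y) x with d = a + 1 = - α(x): each form takes at `w` the value of its
    -- projection at y, and α vanishes there.
    w : Fin N → ℤ
    w v = +[1+ a ] * y v + evalℤ (f i) y * x v
    shift : ∀ t → evalℤ (project +[1+ a ] (f i) x t) y ≡ evalℤ t w
    shift t = trans (cong (_+_ (+[1+ a ] * evalℤ t y)) (ℤₚ.*-comm (evalℤ t x) (evalℤ (f i) y)))
                    (sym (evalℤ-linear +[1+ a ] (evalℤ (f i) y) y x t))
    αw≡0 : evalℤ (f i) w ≡ 0ℤ
    αw≡0 rewrite sym (shift (f i)) | αx = lemma +[1+ a ] (evalℤ (f i) y)
      where
      lemma : ∀ d b → d * b + (- d) * b ≡ 0ℤ
      lemma = solve-∀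
  -- With r the combination found, (k + 1)(d γ + γ(x) α) = d r + r(x) α. Solving for γ gives the
  -- denominator (k + 1) d, stored minus one, the multiplier c = r(x) - (k + 1) γ(x) for α, and the
  -- old multipliers times d.
  ...     | inj₂ (k , us , eq) = inj₂ (a ℕ.+ k ℕ.* suc a , ∣ c ∣ ∷ map (suc a ℕ.*_) us , λ e →
      identity (evalℤ γ (δ e)) (evalℤ (f i) (δ e)) (evalℤ (combination f us is) (δ e)) _
        (trans (eq e) (combination-project f +[1+ a ] (f i) x us is (δ e)))
        (combination-scale f (suc a) us is (δ e)))
    where
    s c : ℤ
    s = evalℤ (combination f us is) x
    c = s - +[1+ k ] * evalℤ γ x
    -- The point x satisfies the old constraints, so r(x) ≥ 0, while γ(x) < 0.
    0≤c : 0ℤ ≤ c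
    0≤c = +-nonNeg {s} (combination-nonNeg f us ps)
      (subst (0ℤ ≤_) (sym (ℤₚ.neg-distribʳ-* +[1+ k ] (evalℤ γ x)))
        (*-nonNeg (suc k) { - evalℤ γ x} (ℤₚ.neg-mono-≤ (ℤₚ.<⇒≤ γx<0))))
    lemma₁ : ∀ k d g b h → (k * d) * g ≡ k * (d * g + h * b) - k * h * b
    lemma₁ = solve-∀
    lemma₂ : ∀ k d h b r s → (d * r + s * b) - k * h * b ≡ (s - k * h) * b + d * r
    lemma₂ = solve-∀
    identity : ∀ g b r r′ → +[1+ k ] * (+[1+ a ] * g + evalℤ γ x * b) ≡ +[1+ a ] * r + s * b →
      r′ ≡ +[1+ a ] * r → +[1+ a ℕ.+ k ℕ.* suc a ] * g ≡ (+ ∣ c ∣) * b + r′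
    identity g b r r′ eq′ refl = begin
      +[1+ k ] * +[1+ a ] * g
        ≡⟨ lemma₁ +[1+ k ] +[1+ a ] g b (evalℤ γ x) ⟩
      +[1+ k ] * (+[1+ a ] * g + evalℤ γ x * b) - +[1+ k ] * evalℤ γ x * b
        ≡⟨ cong (_- +[1+ k ] * evalℤ γ x * b) eq′ ⟩
      (+[1+ a ] * r + s * b) - +[1+ k ] * evalℤ γ x * b
        ≡⟨ lemma₂ +[1+ k ] +[1+ a ] (evalℤ γ x) b r s ⟩
      c * b + +[1+ a ] * r
        ≡⟨ cong (λ c → c * b + +[1+ a ] * r) (ℤₚ.0≤i⇒+∣i∣≡i 0≤c) ⟨
      (+ ∣ c ∣) * b + +[1+ a ] * r ∎
      where open ≡-Reasoning

-- Decomposition of a system of equations into cells.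

_⊟_ : ∀ {V} → Linear V → Linear V → Linear V
a ⊟ b = a ⊕ (-1ℤ ⊛ b)

Cell : Set → Set
Cell V = List (Linear V)

module _ {V : Set} where

  -- The continuation receives the linear form that the term equals on the
  -- cells being built.
  split : Term V → (Linear V → List (Cell V)) → List (Cell V)
  split (var v) k = k (var v)
  split zer     k = k zer
  split (s ⊕ t) k = split s λ a → split t λ b → k (a ⊕ b)
  split (⊝ t)   k = split t λ a → k (-1ℤ ⊛ a)
  split (s ⊔ t) k = split s λ a → split t λ b →
    map ((b ⊟ a) ∷_) (k b) ++ map ((a ⊟ b) ∷_) (k a)
  split (s ⊓ t) k = split s λ a → split t λ b →
    map ((b ⊟ a) ∷_) (k a) ++ map ((a ⊟ b) ∷_) (k b)

  cells : List (Term V × Term V) → List (Cell V)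
  -- The empty conjunction gives one cell without constraints, the whole space.
  cells []             = [] ∷ []
  cells ((s , t) ∷ es) = split s λ a → split t λ b →
    map (λ c → (a ⊟ b) ∷ (b ⊟ a) ∷ c) (cells es)

-- Abelian ℓ-groups as ordered ℤ-modules.

module LGroup (G : AbelianLGroup) where
  open AbelianLGroup G public

  abelianGroup : AbelianGroup _ _
  abelianGroup = record { isAbelianGroup = isAbelianGroup }

  lattice : Alg.Lattice _ _
  lattice = record { isLattice = isLattice }

  open AbelianGroup abelianGroup public
    using (identityˡ; identityʳ; assoc; inverseʳ; commutativeMonoid; commutativeSemigroup)
    renaming (comm to +-comm)
  open Alg.Lattice lattice public using (∨-comm; ∧-comm)
  open Algebra.Properties.AbelianGroup abelianGroup public
    using (ε⁻¹≈ε; ⁻¹-involutive; ⁻¹-∙-comm; xyx⁻¹≈y; x∙y⁻¹≈ε⇒x≈y)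
  open Algebra.Properties.CommutativeSemigroup commutativeSemigroup public using (interchange)
  open Algebra.Properties.CommutativeMonoid.Mult commutativeMonoid public
    using (×-homo-+; ×-distrib-+) renaming (_×_ to _×ₙ_)
  open Algebra.Properties.CommutativeMonoid.Sum commutativeMonoid public
    using (sum; sum-cong-≗; sum-replicate-zero; ∑-distrib-+)
  open Relation.Binary.Lattice.Lattice
    (Algebra.Lattice.Properties.Lattice.∨-∧-orderTheoreticLattice lattice) public
    using (_≤_; x≤x∨y; y≤x∨y; ∨-least; x∧y≤x; x∧y≤y; ∧-greatest; antisym; poset)
    renaming (refl to ≤-refl; trans to ≤-trans; reflexive to ≤-reflexive)

  module ≤-Reasoning = Relation.Binary.Reasoning.PartialOrder poset

  ×ₙ-zeroʳ : ∀ n → n ×ₙ 𝟘 ≡ 𝟘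
  ×ₙ-zeroʳ zero    = refl
  ×ₙ-zeroʳ (suc n) = trans (identityˡ _) (×ₙ-zeroʳ n)

  ·≡×ₙ : ∀ n g → n · g ≡ n ×ₙ g
  ·≡×ₙ zero    g = refl
  ·≡×ₙ (suc n) g = cong (_+_ g) (·≡×ₙ n g)

  infixr 8 _⋆_
  _⋆_ : ℤ → Carrier → Carrier
  (+ n)    ⋆ g = n ×ₙ g
  -[1+ n ] ⋆ g = - (suc n ×ₙ g)

  -- Integer addition with mixed signs computes to `_⊖_`; this supplies the mixed cases of
  -- `⋆-distribʳ`.
  ⊖-⋆ : ∀ m n g → (m ⊖ n) ⋆ g ≡ (m ×ₙ g) + (- (n ×ₙ g))
  ⊖-⋆ m       zero    g = sym (trans (cong (_+_ (m ×ₙ g)) ε⁻¹≈ε) (identityʳ _))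
  ⊖-⋆ zero    (suc n) g = sym (identityˡ _)
  ⊖-⋆ (suc m) (suc n) g = begin
    (suc m ⊖ suc n) ⋆ g                    ≡⟨ cong (_⋆ g) (ℤₚ.[1+m]⊖[1+n]≡m⊖n m n) ⟩
    (m ⊖ n) ⋆ g                            ≡⟨ ⊖-⋆ m n g ⟩
    (m ×ₙ g) + (- (n ×ₙ g))                ≡⟨ identityˡ _ ⟨
    𝟘 + ((m ×ₙ g) + (- (n ×ₙ g)))          ≡⟨ cong (_+ ((m ×ₙ g) + (- (n ×ₙ g)))) (inverseʳ g) ⟨
    (g + (- g)) + ((m ×ₙ g) + (- (n ×ₙ g))) ≡⟨ interchange _ _ _ _ ⟩
    (g + (m ×ₙ g)) + ((- g) + (- (n ×ₙ g))) ≡⟨ cong (_+_ (g + (m ×ₙ g))) (⁻¹-∙-comm g _) ⟩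
    (g + (m ×ₙ g)) + (- (g + (n ×ₙ g)))    ∎
    where open ≡-Reasoning

  ⋆-distribʳ : ∀ a b g → (a Int.+ b) ⋆ g ≡ (a ⋆ g) + (b ⋆ g)
  ⋆-distribʳ (+ m)    (+ n)    g = ×-homo-+ g m n
  ⋆-distribʳ (+ m)    -[1+ n ] g = ⊖-⋆ m (suc n) g
  ⋆-distribʳ -[1+ m ] (+ n)    g = trans (⊖-⋆ n (suc m) g) (+-comm _ _)
  ⋆-distribʳ -[1+ m ] -[1+ n ] g = begin
    - ((suc (suc (m ℕ.+ n))) ×ₙ g)          ≡⟨ cong (λ l → - (suc l ×ₙ g)) (ℕₚ.+-suc m n) ⟨
    - ((suc m ℕ.+ suc n) ×ₙ g)              ≡⟨ cong -_ (×-homo-+ g (suc m) (suc n)) ⟩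
    - ((suc m ×ₙ g) + (suc n ×ₙ g))         ≡⟨ ⁻¹-∙-comm _ _ ⟨
    (- (suc m ×ₙ g)) + (- (suc n ×ₙ g))     ∎
    where open ≡-Reasoning

  ⋆-distribˡ : ∀ c g h → c ⋆ (g + h) ≡ (c ⋆ g) + (c ⋆ h)
  ⋆-distribˡ (+ n)    g h = ×-distrib-+ g h n
  ⋆-distribˡ -[1+ n ] g h = trans (cong -_ (×-distrib-+ g h (suc n))) (sym (⁻¹-∙-comm _ _))

  ⋆-zeroʳ : ∀ c → c ⋆ 𝟘 ≡ 𝟘
  ⋆-zeroʳ (+ n)    = ×ₙ-zeroʳ n
  ⋆-zeroʳ -[1+ n ] = trans (cong -_ (×ₙ-zeroʳ (suc n))) ε⁻¹≈ε

  neg-⋆ : ∀ c g → (Int.- c) ⋆ g ≡ - (c ⋆ g)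
  neg-⋆ (+ zero)  g = sym ε⁻¹≈ε
  neg-⋆ +[1+ n ]  g = refl
  neg-⋆ -[1+ n ]  g = sym (⁻¹-involutive _)

  ×ₙ-⋆ : ∀ n b g → ((+ n) Int.* b) ⋆ g ≡ n ×ₙ (b ⋆ g)
  ×ₙ-⋆ zero    b g = cong (_⋆ g) (ℤₚ.*-zeroˡ b)
  ×ₙ-⋆ (suc n) b g = begin
    ((+ suc n) Int.* b) ⋆ g            ≡⟨ cong (_⋆ g) (ℤₚ.suc-* (+ n) b) ⟩
    (b Int.+ (+ n) Int.* b) ⋆ g        ≡⟨ ⋆-distribʳ b ((+ n) Int.* b) g ⟩
    (b ⋆ g) + (((+ n) Int.* b) ⋆ g)    ≡⟨ cong (_+_ (b ⋆ g)) (×ₙ-⋆ n b g) ⟩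
    (b ⋆ g) + (n ×ₙ (b ⋆ g))           ∎
    where open ≡-Reasoning

  ⋆-assoc : ∀ a b g → (a Int.* b) ⋆ g ≡ a ⋆ (b ⋆ g)
  ⋆-assoc (+ n)    b g = ×ₙ-⋆ n b g
  ⋆-assoc -[1+ n ] b g = begin
    (-[1+ n ] Int.* b) ⋆ g            ≡⟨ cong (_⋆ g) (ℤₚ.neg-distribˡ-* +[1+ n ] b) ⟨
    (Int.- (+[1+ n ] Int.* b)) ⋆ g    ≡⟨ neg-⋆ (+[1+ n ] Int.* b) g ⟩
    - ((+[1+ n ] Int.* b) ⋆ g)        ≡⟨ cong -_ (×ₙ-⋆ (suc n) b g) ⟩
    - (suc n ×ₙ (b ⋆ g))              ∎
    where open ≡-Reasoning

  -- Total order and distributivity are stated by equations in ∨; this lemma and the next two pass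
  -- between such equations and `_≤_`.
  ∨≡⇒≤ : ∀ {a b} → a ∨ b ≡ b → a ≤ b
  ∨≡⇒≤ {a} {b} eq = subst (a ≤_) eq (x≤x∨y a b)

  ≤⇒∨≡ : ∀ {a b} → a ≤ b → a ∨ b ≡ b
  ≤⇒∨≡ {a} {b} a≤b = antisym (∨-least a≤b ≤-refl) (y≤x∨y a b)

  ≤⇒∧≡ : ∀ {a b} → a ≤ b → a ∧ b ≡ a
  ≤⇒∧≡ {a} {b} a≤b = antisym (x∧y≤x a b) (∧-greatest ≤-refl a≤b)

  -- Distributivity turns a ∨ b = b into (c + a) ∨ (c + b) = c + b.
  +-monoʳ-≤ : ∀ c {a b} → a ≤ b → c + a ≤ c + b
  +-monoʳ-≤ c {a} {b} a≤b = ∨≡⇒≤ (trans (sym (+-distrib-∨ c a b)) (cong (_+_ c) (≤⇒∨≡ a≤b)))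

  +-mono-≤ : ∀ {a b c d} → a ≤ b → c ≤ d → a + c ≤ b + d
  +-mono-≤ {a} {b} {c} {d} a≤b c≤d = ≤-trans (+-monoʳ-≤ a c≤d)
    (subst₂ _≤_ (+-comm d a) (+-comm d b) (+-monoʳ-≤ d a≤b))

  +-cancelʳ-≤ : ∀ c {a b} → a + c ≤ b + c → a ≤ b
  +-cancelʳ-≤ c {a} {b} le = subst₂ _≤_ (undo a) (undo b) (+-mono-≤ le (≤-refl { - c}))
    where
    undo : ∀ a → (a + c) + (- c) ≡ a
    undo a = trans (assoc a c (- c)) (trans (cong (_+_ a) (inverseʳ c)) (identityʳ a))

  ≤⇒0≤- : ∀ {a b} → a ≤ b → 𝟘 ≤ b + (- a)
  ≤⇒0≤- {a} {b} le = subst (_≤ b + (- a)) (inverseʳ a) (+-mono-≤ le ≤-refl)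

  0≤-⇒≤ : ∀ {a b} → 𝟘 ≤ b + (- a) → a ≤ b
  0≤-⇒≤ {a} {b} le = +-cancelʳ-≤ (- a) (subst (_≤ b + (- a)) (sym (inverseʳ a)) le)

  ≤-+ʳ : ∀ {a b} → 𝟘 ≤ b → a ≤ a + b
  ≤-+ʳ {a} {b} 0≤b = subst (_≤ a + b) (identityʳ a) (+-monoʳ-≤ a 0≤b)

  ≤-+ˡ : ∀ {a b} → 𝟘 ≤ a → b ≤ a + b
  ≤-+ˡ {a} {b} 0≤a = subst (b ≤_) (+-comm b a) (≤-+ʳ 0≤a)

  +-nonNegᵍ : ∀ {a b} → 𝟘 ≤ a → 𝟘 ≤ b → 𝟘 ≤ a + b
  +-nonNegᵍ 0≤a 0≤b = ≤-trans 0≤a (≤-+ʳ 0≤b)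

  ×ₙ-nonNeg : ∀ n {g} → 𝟘 ≤ g → 𝟘 ≤ n ×ₙ g
  ×ₙ-nonNeg zero    0≤g = ≤-refl
  ×ₙ-nonNeg (suc n) 0≤g = +-nonNegᵍ 0≤g (×ₙ-nonNeg n 0≤g)

  ⋆-nonNeg : ∀ {c g} → 0ℤ Int.≤ c → 𝟘 ≤ g → 𝟘 ≤ c ⋆ g
  ⋆-nonNeg {+ n} _ 0≤g = ×ₙ-nonNeg n 0≤g

  -- With c = -(k + 1), the multiple k g is nonnegative, whence g ≤ (k + 1) g = 0.
  ⋆-negative : ∀ {c g} → c Int.< 0ℤ → 𝟘 ≤ g → c ⋆ g ≡ 𝟘 → g ≡ 𝟘
  ⋆-negative { -[1+ k ]} {g} _ 0≤g eq = antisym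
    (subst (g ≤_) (trans (sym (⁻¹-involutive _)) (trans (cong -_ eq) ε⁻¹≈ε))
      (≤-+ʳ (×ₙ-nonNeg k 0≤g)))
    0≤g
  ⋆-negative {+ k} (Int.+<+ ())

  ×ₙ-mono-≤ : ∀ n {g h} → g ≤ h → n ×ₙ g ≤ n ×ₙ h
  ×ₙ-mono-≤ zero    le = ≤-refl
  ×ₙ-mono-≤ (suc n) le = +-mono-≤ le (×ₙ-mono-≤ n le)

  -- Linear forms evaluated in the group.

  module _ {V : Set} where

    eval : Linear V → (V → Carrier) → Carrier
    eval (var v) ρ = ρ v
    eval zer     ρ = 𝟘
    eval (s ⊕ t) ρ = eval s ρ + eval t ρ
    eval (c ⊛ t) ρ = c ⋆ eval t ρ

    eval-cong : ∀ {ρ σ : V → Carrier} → ρ ≗ σ → ∀ t → eval t ρ ≡ eval t σ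
    eval-cong eq (var v) = eq v
    eval-cong eq zer     = refl
    eval-cong eq (s ⊕ t) = cong₂ _+_ (eval-cong eq s) (eval-cong eq t)
    eval-cong eq (c ⊛ t) = cong (c ⋆_) (eval-cong eq t)

    eval-⊟ : ∀ s t ρ → eval (s ⊟ t) ρ ≡ eval s ρ + (- eval t ρ)
    eval-⊟ s t ρ = cong (λ g → eval s ρ + (- g)) (identityʳ (eval t ρ))

    -- Carries an integer point y into the group along the multiples of a single g, so that facts
    -- over ℤ become facts about G.
    eval-multiples : ∀ t (y : V → ℤ) g → eval t (λ v → y v ⋆ g) ≡ evalℤ t y ⋆ g
    eval-multiples (var v) y g = refl
    eval-multiples zer     y g = refl
    eval-multiples (s ⊕ t) y g = trans (cong₂ _+_ (eval-multiples s y g) (eval-multiples t y g))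
      (sym (⋆-distribʳ (evalℤ s y) (evalℤ t y) g))
    eval-multiples (c ⊛ t) y g = trans (cong (c ⋆_) (eval-multiples t y g))
      (sym (⋆-assoc c (evalℤ t y) g))

    Inside : (V → Carrier) → Cell V → Set
    Inside ρ = All (λ a → 𝟘 ≤ eval a ρ)

    combination-nonNegᵍ : ∀ us {c ρ} → Inside ρ c → 𝟘 ≤ eval (combination id us c) ρ
    combination-nonNegᵍ []       ps       = ≤-refl
    combination-nonNegᵍ (u ∷ us) []       = ≤-refl
    combination-nonNegᵍ (u ∷ us) (p ∷ ps) = +-nonNegᵍ (×ₙ-nonNeg u p) (combination-nonNegᵍ us ps)

  eval-rename : ∀ {V W : Set} (σ : V → W) t ρ → eval (rename σ t) ρ ≡ eval t (ρ ∘ σ)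
  eval-rename σ (var v) ρ = refl
  eval-rename σ zer     ρ = refl
  eval-rename σ (s ⊕ t) ρ = cong₂ _+_ (eval-rename σ s ρ) (eval-rename σ t ρ)
  eval-rename σ (c ⊛ t) ρ = cong (c ⋆_) (eval-rename σ t ρ)

  inside-multiples : ∀ {V} {c : Cell V} {y g} → 𝟘 ≤ g → All (λ a → 0ℤ Int.≤ evalℤ a y) c →
    Inside (λ v → y v ⋆ g) c
  inside-multiples {y = y} {g} 0≤g = All.map λ {a} p →
    subst (𝟘 ≤_) (sym (eval-multiples a y g)) (⋆-nonNeg p 0≤g)

  inside-rename : ∀ {V W : Set} (σ : V → W) {c ρ} → Inside ρ (map (rename σ) c) → Inside (ρ ∘ σ) c
  inside-rename σ {ρ = ρ} ps = All.map (λ {a} → subst (𝟘 ≤_) (eval-rename σ a ρ)) (All.map⁻ ps)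

  combination-rename : ∀ {V W : Set} (σ : V → W) us c ρ →
    eval (combination id us (map (rename σ) c)) ρ ≡ eval (combination id us c) (ρ ∘ σ)
  combination-rename σ []       c       ρ = refl
  combination-rename σ (u ∷ us) []      ρ = refl
  combination-rename σ (u ∷ us) (a ∷ c) ρ =
    cong₂ _+_ (cong (u ×ₙ_) (eval-rename σ a ρ)) (combination-rename σ us c ρ)

  -- The multipliers are cut at the length of c. Each cell receives its own share, read in its own
  -- variables.
  combination-++ : ∀ {U V W : Set} (σ : U → W) (τ : V → W) us c d → ∃₂ λ vs ws → ∀ ρ →
    eval (combination id us (map (rename σ) c ++ map (rename τ) d)) ρ
      ≡ eval (combination id vs c) (ρ ∘ σ) + eval (combination id ws d) (ρ ∘ τ)
  combination-++ σ τ us       []      d = [] , us , λ ρ →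
    trans (combination-rename τ us d ρ) (sym (identityˡ _))
  combination-++ σ τ []       (a ∷ c) d = [] , [] , λ ρ → sym (identityˡ 𝟘)
  combination-++ σ τ (u ∷ us) (a ∷ c) d with combination-++ σ τ us c d
  ... | vs , ws , eq = u ∷ vs , ws , λ ρ →
    trans (cong₂ _+_ (cong (u ×ₙ_) (eval-rename σ a ρ)) (eq ρ)) (sym (assoc _ _ _))

  sum-δ : ∀ {N} (v : Fin N) (ρ : Fin N → Carrier) → sum (λ i → δ i v ⋆ ρ i) ≡ ρ v
  sum-δ {suc N} zero    ρ = trans (cong₂ _+_ (identityʳ _) (sum-replicate-zero N)) (identityʳ _)
  sum-δ         (suc v) ρ = trans (identityˡ _) (sum-δ v (ρ ∘ suc))

  ⋆-distrib-sum : ∀ {N} c (f : Fin N → Carrier) → sum (λ i → c ⋆ f i) ≡ c ⋆ sum f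
  ⋆-distrib-sum {zero}  c f = sym (⋆-zeroʳ c)
  ⋆-distrib-sum {suc N} c f = trans (cong (_+_ (c ⋆ f zero)) (⋆-distrib-sum c (f ∘ suc)))
    (sym (⋆-distribˡ c (f zero) _))

  eval-coordinates : ∀ {N} (t : Linear (Fin N)) ρ →
    eval t ρ ≡ sum (λ i → evalℤ t (δ i) ⋆ ρ i)
  eval-coordinates     (var v) ρ = sym (sum-δ v ρ)
  eval-coordinates {N} zer     ρ = sym (sum-replicate-zero N)
  eval-coordinates     (s ⊕ t) ρ = begin
    eval s ρ + eval t ρ
      ≡⟨ cong₂ _+_ (eval-coordinates s ρ) (eval-coordinates t ρ) ⟩
    sum (λ i → evalℤ s (δ i) ⋆ ρ i) + sum (λ i → evalℤ t (δ i) ⋆ ρ i)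
      ≡⟨ ∑-distrib-+ (λ i → evalℤ s (δ i) ⋆ ρ i) (λ i → evalℤ t (δ i) ⋆ ρ i) ⟨
    sum (λ i → (evalℤ s (δ i) ⋆ ρ i) + (evalℤ t (δ i) ⋆ ρ i))
      ≡⟨ sum-cong-≗ (λ i → ⋆-distribʳ (evalℤ s (δ i)) (evalℤ t (δ i)) (ρ i)) ⟨
    sum (λ i → evalℤ (s ⊕ t) (δ i) ⋆ ρ i) ∎
    where open ≡-Reasoning
  eval-coordinates     (c ⊛ t) ρ = begin
    c ⋆ eval t ρ
      ≡⟨ cong (c ⋆_) (eval-coordinates t ρ) ⟩
    c ⋆ sum (λ i → evalℤ t (δ i) ⋆ ρ i)
      ≡⟨ ⋆-distrib-sum c (λ i → evalℤ t (δ i) ⋆ ρ i) ⟨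
    sum (λ i → c ⋆ (evalℤ t (δ i) ⋆ ρ i))
      ≡⟨ sum-cong-≗ (λ i → ⋆-assoc c (evalℤ t (δ i)) (ρ i)) ⟨
    sum (λ i → evalℤ (c ⊛ t) (δ i) ⋆ ρ i) ∎
    where open ≡-Reasoning

  -- Turns a Farkas certificate, an identity between integer coefficients, into an identity in the
  -- group.
  eval-determined : ∀ {N} (s t : Linear (Fin N)) → (∀ e → evalℤ s (δ e) ≡ evalℤ t (δ e)) →
    ∀ ρ → eval s ρ ≡ eval t ρ
  eval-determined s t eq ρ = trans (eval-coordinates s ρ)
    (trans (sum-cong-≗ (λ e → cong (_⋆ ρ e) (eq e))) (sym (eval-coordinates t ρ)))

-- Totally ordered groups and correctness of the cells.

module Ordered (D : AbelianLGroup) (tot : TotallyOrdered D) where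
  open LGroup D public

  ≤-total : ∀ a b → a ≤ b ⊎ b ≤ a
  ≤-total a b with tot a b
  ... | inj₁ eq = inj₁ (∨≡⇒≤ eq)
  ... | inj₂ eq = inj₂ (∨≡⇒≤ eq)

  trivial⇒≤ : (∀ g → 𝟘 ≤ g → g ≡ 𝟘) → ∀ a b → a ≤ b
  trivial⇒≤ triv a b with ≤-total a b
  ... | inj₁ a≤b = a≤b
  ... | inj₂ b≤a = ≤-reflexive (x∙y⁻¹≈ε⇒x≈y a b (triv _ (≤⇒0≤- b≤a)))

  -- If h ≤ g, then g + n g ≤ h + n h ≤ h + n g, and n g cancels.
  ×ₙ-cancel-≤ : ∀ n {g h} → suc n ×ₙ g ≤ suc n ×ₙ h → g ≤ h
  ×ₙ-cancel-≤ n {g} {h} le with ≤-total g h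
  ... | inj₁ g≤h = g≤h
  ... | inj₂ h≤g = +-cancelʳ-≤ (n ×ₙ g) (≤-trans le (+-monoʳ-≤ h (×ₙ-mono-≤ n h≤g)))

  -- Two pointwise equal valuations, because the one used by Sat has no name.
  module _ {V : Set} (ρ ρ′ : V → Carrier) (ρ≗ρ′ : ρ ≗ ρ′) where

    private
      above : ∀ a b → eval a ρ ≤ eval b ρ → 𝟘 ≤ eval (b ⊟ a) ρ
      above a b le = subst (𝟘 ≤_) (sym (eval-⊟ b a ρ)) (≤⇒0≤- le)

      below : ∀ a b → 𝟘 ≤ eval (b ⊟ a) ρ → eval a ρ ≤ eval b ρ
      below a b le = 0≤-⇒≤ (subst (𝟘 ≤_) (eval-⊟ b a ρ) le)

      uncons : ∀ {a : Linear V} {k : List (Cell V)} → Any (Inside ρ) (map (a ∷_) k) →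
        𝟘 ≤ eval a ρ × Any (Inside ρ) k
      uncons p with Any.map⁻ p
      ... | q = All.head (proj₂ (Any.satisfied q)) , Any.map All.tail q

    -- The total order decides which branch of each ⊔ or ⊓ contains ρ. The continuation is entered
    -- with a form whose value at ρ is that of the term.
    split-complete : ∀ t k → (∀ a → eval a ρ ≡ ⟦ D ⟧ t ρ′ → Any (Inside ρ) (k a)) →
      Any (Inside ρ) (split t k)
    split-complete (var v) k h = h _ (ρ≗ρ′ v)
    split-complete zer     k h = h _ refl
    split-complete (s ⊕ t) k h = split-complete s _ λ a p → split-complete t _ λ b q →
      h _ (cong₂ _+_ p q)
    split-complete (⊝ t)   k h = split-complete t _ λ a p →
      h _ (trans (cong -_ (identityʳ _)) (cong -_ p))
    split-complete (s ⊔ t) k h = split-complete s _ λ a p → split-complete t _ λ b q →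
      [ (λ le → Any.++⁺ˡ (Any.map⁺ (Any.map (above a b le ∷_)
          (h b (trans (sym (≤⇒∨≡ le)) (cong₂ _∨_ p q))))))
      , (λ le → Any.++⁺ʳ _ (Any.map⁺ (Any.map (above b a le ∷_)
          (h a (trans (sym (≤⇒∨≡ le)) (trans (∨-comm _ _) (cong₂ _∨_ p q)))))))
      ]′ (≤-total (eval a ρ) (eval b ρ))
    split-complete (s ⊓ t) k h = split-complete s _ λ a p → split-complete t _ λ b q →
      [ (λ le → Any.++⁺ˡ (Any.map⁺ (Any.map (above a b le ∷_)
          (h a (trans (sym (≤⇒∧≡ le)) (cong₂ _∧_ p q))))))
      , (λ le → Any.++⁺ʳ _ (Any.map⁺ (Any.map (above b a le ∷_)
          (h b (trans (sym (≤⇒∧≡ le)) (trans (∧-comm _ _) (cong₂ _∧_ p q)))))))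
      ]′ (≤-total (eval a ρ) (eval b ρ))

    -- The inequalities recorded at the head of a cell tell which argument each ⊔ or ⊓ equals at ρ.
    -- The arbitrary answer type R lets calls nest in the way `split` nests its continuations.
    split-sound : ∀ {R : Set} t k →
      (∀ a → eval a ρ ≡ ⟦ D ⟧ t ρ′ → Any (Inside ρ) (k a) → R) →
      Any (Inside ρ) (split t k) → R
    split-sound (var v) k h = h _ (ρ≗ρ′ v)
    split-sound zer     k h = h _ refl
    split-sound (s ⊕ t) k h = split-sound s _ λ a p → split-sound t _ λ b q →
      h _ (cong₂ _+_ p q)
    split-sound (⊝ t)   k h = split-sound t _ λ a p →
      h _ (trans (cong -_ (identityʳ _)) (cong -_ p))
    split-sound (s ⊔ t) k h = split-sound s _ λ a p → split-sound t _ λ b q r →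
      [ (λ r′ → let (c , r″) = uncons r′ ; le = below a b c in
          h b (trans (sym (≤⇒∨≡ le)) (cong₂ _∨_ p q)) r″)
      , (λ r′ → let (c , r″) = uncons r′ ; le = below b a c in
          h a (trans (sym (≤⇒∨≡ le)) (trans (∨-comm _ _) (cong₂ _∨_ p q))) r″)
      ]′ (Any.++⁻ _ r)
    split-sound (s ⊓ t) k h = split-sound s _ λ a p → split-sound t _ λ b q r →
      [ (λ r′ → let (c , r″) = uncons r′ ; le = below a b c in
          h a (trans (sym (≤⇒∧≡ le)) (cong₂ _∧_ p q)) r″)
      , (λ r′ → let (c , r″) = uncons r′ ; le = below b a c in
          h b (trans (sym (≤⇒∧≡ le)) (trans (∧-comm _ _) (cong₂ _∧_ p q))) r″)
      ]′ (Any.++⁻ _ r)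

    cells-complete : ∀ {es} → All (λ e → ⟦ D ⟧ (proj₁ e) ρ′ ≡ ⟦ D ⟧ (proj₂ e) ρ′) es →
      Any (Inside ρ) (cells es)
    cells-complete []                          = here []
    cells-complete (_∷_ {x = s , t} eq eqs) = split-complete s _ λ a p → split-complete t _ λ b q →
      let a≡b = trans p (trans eq (sym q)) in
      Any.map⁺ (Any.map (λ ps → above b a (≤-reflexive (sym a≡b)) ∷ above a b (≤-reflexive a≡b) ∷ ps)
        (cells-complete eqs))

    cells-sound : ∀ es → Any (Inside ρ) (cells es) →
      All (λ e → ⟦ D ⟧ (proj₁ e) ρ′ ≡ ⟦ D ⟧ (proj₂ e) ρ′) es
    cells-sound []             _ = []
    cells-sound ((s , t) ∷ es)   = split-sound s _ λ a p → split-sound t _ λ b q r →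
      let r′      = Any.map⁻ r
          (_ , ps) = Any.satisfied r′
          a≡b     = antisym (below a b (All.head (All.tail ps))) (below b a (All.head ps))
      in trans (sym p) (trans a≡b q) ∷ cells-sound es (Any.map (All.tail ∘ All.tail) r′)

-- Terms with division.

multiple : ∀ {V} → ℕ → DTerm V → DTerm V
multiple zero    t = zer
multiple (suc n) t = t ⊕ multiple n t

-- Substitutes 0 for the variables z.
xPart : ∀ {X Z : Set} → Linear (X ⊎ Z) → DTerm X
xPart (var (inj₁ i)) = var i
xPart (var (inj₂ j)) = zer
xPart zer            = zer
xPart (s ⊕ t)        = xPart s ⊕ xPart t
xPart ((+ n) ⊛ t)    = multiple n (xPart t)
xPart (-[1+ n ] ⊛ t) = ⊝ multiple (suc n) (xPart t)

module DivisibleTerms (D : AbelianLGroup) (tot : TotallyOrdered D) (div-D : Divisible D) where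
  open Ordered D tot public

  value : ∀ {V} → DTerm V → (V → Carrier) → Carrier
  value = ⟦_⟧̄ D div-D

  value-multiple : ∀ {V : Set} n (t : DTerm V) ρ → value (multiple n t) ρ ≡ n ×ₙ value t ρ
  value-multiple zero    t ρ = refl
  value-multiple (suc n) t ρ = cong (_+_ (value t ρ)) (value-multiple n t ρ)

  value-xPart : ∀ {X Z : Set} (t : Linear (X ⊎ Z)) x →
    value (xPart t) x ≡ eval t [ x , (λ _ → 𝟘) ]′
  value-xPart (var (inj₁ i)) x = refl
  value-xPart (var (inj₂ j)) x = refl
  value-xPart zer            x = refl
  value-xPart (s ⊕ t)        x = cong₂ _+_ (value-xPart s x) (value-xPart t x)
  value-xPart ((+ n) ⊛ t)    x =
    trans (value-multiple n (xPart t) x) (cong (n ×ₙ_) (value-xPart t x))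
  value-xPart (-[1+ n ] ⊛ t) x = cong -_
    (trans (value-multiple (suc n) (xPart t) x) (cong (suc n ×ₙ_) (value-xPart t x)))

  value-div : ∀ {V : Set} k (t : DTerm V) ρ → suc k ×ₙ value (div k t) ρ ≡ value t ρ
  value-div k t ρ = trans (sym (·≡×ₙ (suc k) _)) (proj₂ (div-D (value t ρ) k))

  ⋀-lower : ∀ {V} (t : DTerm V) ts {s} x → s ∈ ts → value (foldr _⊓_ t ts) x ≤ value s x
  ⋀-lower t (u ∷ ts) x (here refl) = x∧y≤x _ _
  ⋀-lower t (u ∷ ts) x (there s∈)  = ≤-trans (x∧y≤y _ _) (⋀-lower t ts x s∈)

  ⋀-greatest : ∀ {V} {t : DTerm V} {ts c} x → c ≤ value t x → All (λ s → c ≤ value s x) ts →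
    c ≤ value (foldr _⊓_ t ts) x
  ⋀-greatest x c≤ []       = c≤
  ⋀-greatest x c≤ (p ∷ ps) = ∧-greatest p (⋀-greatest x c≤ ps)

  ⋁-upper : ∀ {V} (t : DTerm V) ts {s} x → s ∈ ts → value s x ≤ value (foldr _⊔_ t ts) x
  ⋁-upper t (u ∷ ts) x (here refl) = x≤x∨y _ _
  ⋁-upper t (u ∷ ts) x (there s∈)  = ≤-trans (⋁-upper t ts x s∈) (y≤x∨y _ _)

  ⋁-least : ∀ {V} {t : DTerm V} {ts c} x → value t x ≤ c → All (λ s → value s x ≤ c) ts →
    value (foldr _⊔_ t ts) x ≤ c
  ⋁-least x ≤c []       = ≤c
  ⋁-least x ≤c (p ∷ ps) = ∨-least p (⋁-least x ≤c ps)

  -- The defining term.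

  module Definability {n m} (φ : EFD n m) (h : Holds D φ) (j : Fin (suc m)) where

    M N : ℕ
    M = suc m
    N = n ℕ.+ (M ℕ.+ M)

    F : (Fin n → Carrier) → Carrier
    F = [_]_ D {φ = φ} h j

    allCells : List (Cell (Fin n ⊎ Fin M))
    allCells = cells (EFD.equations φ)

    -- Two copies of the variables of α in one block: the first n places hold the shared x, then
    -- come z and z′.
    left right : Fin n ⊎ Fin M → Fin N
    left  = [ _↑ˡ (M ℕ.+ M) , (λ i → n ↑ʳ (i ↑ˡ M)) ]′
    right = [ _↑ˡ (M ℕ.+ M) , (λ i → n ↑ʳ (M ↑ʳ i)) ]′

    join : (Fin n → Carrier) → (z z′ : Fin M → Carrier) → Fin N → Carrier
    join x z z′ = x V.++ (z V.++ z′)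

    join-left : ∀ x z z′ → join x z z′ ∘ left ≗ [ x , z ]′
    join-left x z z′ (inj₁ i) = V.lookup-++ˡ x (z V.++ z′) i
    join-left x z z′ (inj₂ i) =
      trans (V.lookup-++ʳ x (z V.++ z′) (i ↑ˡ M)) (V.lookup-++ˡ z z′ i)

    join-right : ∀ x z z′ → join x z z′ ∘ right ≗ [ x , z′ ]′
    join-right x z z′ (inj₁ i) = V.lookup-++ˡ x (z V.++ z′) i
    join-right x z z′ (inj₂ i) =
      trans (V.lookup-++ʳ x (z V.++ z′) (M ↑ʳ i)) (V.lookup-++ʳ z z′ i)

    constraints : (P Q : Cell (Fin n ⊎ Fin M)) → Cell (Fin N)
    constraints P Q = map (rename left) P ++ map (rename right) Q

    gap : Linear (Fin N)
    gap = var (right (inj₂ j)) ⊟ var (left (inj₂ j))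

    -- This is A_PQ: the x-part of P's share of the certificate, divided by k + 1. A violation
    -- forces D to be trivial, so `zer` serves there. The outcome of Farkas' lemma is an argument so
    -- that `separates` can match on it.
    separatorFrom : ∀ P Q → Violation id (constraints P Q) gap ⊎ Certificate id (constraints P Q) gap →
      DTerm (Fin n)
    separatorFrom P Q (inj₁ _)            = zer
    separatorFrom P Q (inj₂ (k , us , _)) =
      div k (xPart (combination id (proj₁ (combination-++ left right us P Q)) P))

    separator : (P Q : Cell (Fin n ⊎ Fin M)) → DTerm (Fin n)
    separator P Q = separatorFrom P Q (farkas id (constraints P Q) gap)

    -- Soundness of the cells makes ρ a solution of α; uniqueness in φ then fixes its j-th
    -- coordinate.
    inside-unique : ∀ {P} → P ∈ allCells → ∀ ρ → Inside ρ P → ρ (inj₂ j) ≡ F (ρ ∘ inj₁)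
    inside-unique P∈ ρ ps = proj₂ (proj₂ (h (ρ ∘ inj₁))) (ρ ∘ inj₂)
      (cells-sound ρ _ (λ { (inj₁ i) → refl ; (inj₂ i) → refl }) (EFD.equations φ) (lose P∈ ps)) j

    -- An integer violation scaled by g ≥ 0 gives two solutions over the same x
    -- whose j-th coordinates differ by a nonzero multiple of g.
    violation⇒trivial : ∀ {P Q} → P ∈ allCells → Q ∈ allCells →
      Violation id (constraints P Q) gap → ∀ g → 𝟘 ≤ g → g ≡ 𝟘
    violation⇒trivial {P} {Q} P∈ Q∈ (y , ps , gap<0) g 0≤g = ⋆-negative gap<0 0≤g (begin
      evalℤ gap y ⋆ g
        ≡⟨ eval-multiples gap y g ⟨
      eval gap w
        ≡⟨ eval-⊟ (var (right (inj₂ j))) (var (left (inj₂ j))) w ⟩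
      w (right (inj₂ j)) + (- w (left (inj₂ j)))
        ≡⟨ cong (λ a → a + (- w (left (inj₂ j)))) (trans unique-right (sym unique-left)) ⟩
      w (left (inj₂ j)) + (- w (left (inj₂ j)))
        ≡⟨ inverseʳ _ ⟩
      𝟘 ∎)
      where
      open ≡-Reasoning
      w : Fin N → Carrier
      w v = y v ⋆ g
      inside : Inside w (constraints P Q)
      inside = inside-multiples 0≤g ps
      unique-left : w (left (inj₂ j)) ≡ F (λ i → w (left (inj₁ i)))
      unique-left = inside-unique P∈ (w ∘ left) (inside-rename left (All.++⁻ˡ _ inside))
      unique-right : w (right (inj₂ j)) ≡ F (λ i → w (left (inj₁ i)))
      unique-right = inside-unique Q∈ (w ∘ right)
        (inside-rename right (All.++⁻ʳ (map (rename left) P) inside))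

    -- The certificate for z′_j - z_j evaluated at (x, z, z′). It is an identity in both z and z′,
    -- so either may later be set to 0.
    certificate-identity : ∀ P Q ((k , us , _) : Certificate id (constraints P Q) gap) →
      let (vs , ws , _) = combination-++ left right us P Q in ∀ x z z′ →
      suc k ×ₙ z′ j ≡ (suc k ×ₙ z j)
        + (eval (combination id vs P) [ x , z ]′ + eval (combination id ws Q) [ x , z′ ]′)
    certificate-identity P Q (k , us , eq) x z z′ with combination-++ left right us P Q
    ... | vs , ws , eq-++ = begin
      suc k ×ₙ z′ j
        ≡⟨ cong (suc k ×ₙ_) (trans (sym (assoc _ _ _)) (xyx⁻¹≈y (z j) (z′ j))) ⟨
      suc k ×ₙ (z j + (z′ j + (- z j)))
        ≡⟨ ×-distrib-+ (z j) _ (suc k) ⟩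
      (suc k ×ₙ z j) + (suc k ×ₙ (z′ j + (- z j)))
        ≡⟨ cong (λ g → (suc k ×ₙ z j) + (suc k ×ₙ g)) eval-gap ⟨
      (suc k ×ₙ z j) + eval (+[1+ k ] ⊛ gap) w
        ≡⟨ cong (_+_ (suc k ×ₙ z j)) (eval-determined (+[1+ k ] ⊛ gap) (combination id us (constraints P Q)) eq w) ⟩
      (suc k ×ₙ z j) + eval (combination id us (constraints P Q)) w
        ≡⟨ cong (_+_ (suc k ×ₙ z j)) (trans (eq-++ w) (cong₂ _+_
             (eval-cong (join-left x z z′) (combination id vs P))
             (eval-cong (join-right x z z′) (combination id ws Q)))) ⟩
      (suc k ×ₙ z j) + (eval (combination id vs P) [ x , z ]′ + eval (combination id ws Q) [ x , z′ ]′) ∎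
      where
      open ≡-Reasoning
      w : Fin N → Carrier
      w = join x z z′
      eval-gap : eval gap w ≡ z′ j + (- z j)
      eval-gap = trans (eval-⊟ (var (right (inj₂ j))) (var (left (inj₂ j))) w)
        (cong₂ (λ a b → a + (- b)) (join-right x z z′ (inj₂ j)) (join-left x z z′ (inj₂ j)))

    separates : ∀ {P Q} → P ∈ allCells → Q ∈ allCells → ∀ r x →
      (∀ z → Inside [ x , z ]′ P → z j ≤ value (separatorFrom P Q r) x)
      × (∀ z → Inside [ x , z ]′ Q → value (separatorFrom P Q r) x ≤ z j)
    separates P∈ Q∈ (inj₁ viol) x =
      (λ _ _ → trivial⇒≤ (violation⇒trivial P∈ Q∈ viol) _ _) ,
      (λ _ _ → trivial⇒≤ (violation⇒trivial P∈ Q∈ viol) _ _)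
    separates {P} {Q} P∈ Q∈ (inj₂ cert@(k , us , _)) x =
      -- On P the share `A z` is nonnegative. Setting z′ = 0 bounds K z + B 0 by K 0, and z = z′ = 0
      -- rewrites K 0 as A 0 + B 0.
      (λ z ps → ×ₙ-cancel-≤ k (+-cancelʳ-≤ (B 0ᶻ) (begin
        K z + B 0ᶻ            ≤⟨ +-monoʳ-≤ (K z) (≤-+ˡ (combination-nonNegᵍ vs ps)) ⟩
        K z + (A z + B 0ᶻ)    ≡⟨ identity z 0ᶻ ⟨
        K 0ᶻ                  ≡⟨ identity₀ 0ᶻ ⟩
        A 0ᶻ + B 0ᶻ           ≡⟨ cong (_+ B 0ᶻ) A≡ ⟨
        suc k ×ₙ A/K + B 0ᶻ   ∎))) ,
      -- Here the P-side solution is set to 0, which gives K z = A 0 + B z, and B z is nonnegative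
      -- on Q.
      (λ z qs → ×ₙ-cancel-≤ k (begin
        suc k ×ₙ A/K   ≡⟨ A≡ ⟩
        A 0ᶻ           ≤⟨ ≤-+ʳ (combination-nonNegᵍ ws qs) ⟩
        A 0ᶻ + B z     ≡⟨ identity₀ z ⟨
        K z            ∎))
      where
      open ≤-Reasoning
      vs ws : List ℕ
      vs = proj₁ (combination-++ left right us P Q)
      ws = proj₁ (proj₂ (combination-++ left right us P Q))
      0ᶻ : Fin M → Carrier
      0ᶻ _ = 𝟘
      A B K : (Fin M → Carrier) → Carrier
      A z = eval (combination id vs P) [ x , z ]′
      B z = eval (combination id ws Q) [ x , z ]′
      K z = suc k ×ₙ z j
      A/K : Carrier
      A/K = value (separatorFrom P Q (inj₂ cert)) x
      A≡ : suc k ×ₙ A/K ≡ A 0ᶻ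
      A≡ = trans (value-div k (xPart (combination id vs P)) x) (value-xPart (combination id vs P) x)
      identity : ∀ z z′ → K z′ ≡ K z + (A z + B z′)
      identity = certificate-identity P Q cert x
      identity₀ : ∀ z → K z ≡ A 0ᶻ + B z
      identity₀ z = trans (identity 0ᶻ z)
        (trans (cong (_+ (A 0ᶻ + B z)) (×ₙ-zeroʳ (suc k))) (identityˡ _))

    inhabited : ∀ x → ∃ λ P → P ∈ allCells × Inside [ x , proj₁ (h x) ]′ P
    inhabited x = find (cells-complete [ x , proj₁ (h x) ]′ _
      (λ { (inj₁ i) → refl ; (inj₂ i) → refl }) (proj₁ (proj₂ (h x))))

    -- The fold needs a starting term; for P in `allCells`, `separator P P` already occurs in the
    -- list and leaves the meet unchanged.
    row : Cell (Fin n ⊎ Fin M) → DTerm (Fin n)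
    row P = foldr _⊓_ (separator P P) (map (separator P) allCells)

    -- The starting term is the row of a cell containing the solution over x = 0; that cell lies in
    -- `allCells`, so the join is unchanged.
    definition : DTerm (Fin n)
    definition = foldr _⊔_ (row (proj₁ (inhabited (λ _ → 𝟘)))) (map row allCells)

    definition-correct : ∀ x → value definition x ≡ F x
    definition-correct x with inhabited x
    ... | P , P∈ , ps = antisym
      (⋁-least x (row≤ (proj₁ (proj₂ (inhabited (λ _ → 𝟘))))) (All.map⁺ (All.tabulate row≤)))
      (≤-trans
        (⋀-greatest x (≤separator P∈) (All.map⁺ (All.tabulate ≤separator)))
        (⋁-upper _ _ x (∈-map⁺ row P∈)))
      where
      ≤separator : ∀ {Q} → Q ∈ allCells → F x ≤ value (separator P Q) x
      ≤separator Q∈ = proj₁ (separates P∈ Q∈ (farkas id _ gap) x) _ ps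
      row≤ : ∀ {R} → R ∈ allCells → value (row R) x ≤ F x
      row≤ {R} R∈ = ≤-trans (⋀-lower _ _ x (∈-map⁺ (separator R) P∈))
        (proj₂ (separates R∈ P∈ (farkas id _ gap) x) _ ps)

theorem4p3 : (D : AbelianLGroup) → TotallyOrdered D → (div-D : Divisible D) →
    ∀ {n m} (φ : EFD n m) (h : Holds D φ) →
    (j : Fin (suc m)) → IsTermFunctionD̄ D div-D ([_]_ D {φ = φ} h j)
theorem4p3 D tot div-D φ h j = definition , definition-correct
  where open DivisibleTerms.Definability D tot div-D φ h j
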